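{- Let $\mathbf{L}\in\{DmbCciw,\,DmbCci,\,DbC,\,DCi\}$. For every set $\Gamma\cup\{\varphi\}\subseteq For(\Sigma)$, if $\Gamma\vDash_{\mathbf{L}}\varphi$, then $\Gamma\vdash_{\mathbf{L}}\varphi$.
   Context: **Syntax.** $For(\Sigma)$ is the set of formulas generated from a denumerable set of propositional variables by the signature $\Sigma=\{\to,\neg,\lor,\land,\mathsf{O},\circ\}$ ($\neg,\mathsf{O},\circ$ unary; $\to,\lor,\land$ binary). **The logics.** $DmbC$ is the Hilbert calculus whose axiom schemas are those of $CPL^+$, the positive fragment of classical propositional logic in $\to,\land,\lor$ (for instance: $\alpha\to(\beta\to\alpha)$; $(\alpha\to(\beta\to\gamma))\to((\alpha\to\beta)\to(\alpha\to\gamma))$; $\alpha\to(\beta\to(\alpha\land\beta))$; $(\alpha\land\beta)\to\alpha$; $(\alpha\land\beta)\to\beta$; $\alpha\to(\alpha\lor\beta)$; $\beta\to(\alpha\lor\beta)$; $(\alpha\to\gamma)\to((\beta\to\gamma)\to((\alpha\lor\beta)\to\gamma))$; $\alpha\lor(\alpha\to\beta)$), plus (EM) $\alpha\lor\neg\alpha$; (bc) $\circ\alpha\to(\alpha\to(\neg\alpha\to\beta))$; ($\mathsf{O}$-K) $\mathsf{O}(\alpha\to\beta)\to(\mathsf{O}\alpha\to\mathsf{O}\beta)$; ($\mathsf{O}$-E) $\mathsf{O}\bot_\alpha\to\bot_\alpha$, where $\bot_\alpha:=(\alpha\land\neg\alpha)\land\circ\alpha$. The rules are Modus Ponens and $\mathsf{O}$-necessitation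 (from $\varphi$ infer $\mathsf{O}\varphi$). Consider the schemas (ciw) $\circ\alpha\lor(\alpha\land\neg\alpha)$; (ci) $\neg\circ\alpha\to(\alpha\land\neg\alpha)$; (cf) $\neg\neg\alpha\to\alpha$. Then $DmbCciw=DmbC+$(ciw); $DmbCci=DmbC+$(ci); $DbC=DmbC+$(cf); $DCi=DmbCci+$(cf). $\vdash_{\mathbf{L}}\varphi$ means that there is a finite derivation of $\varphi$ from axioms of $\mathbf{L}$ (no premises) using the rules. $\Gamma\vdash_{\mathbf{L}}\varphi$ means: either $\vdash_{\mathbf{L}}\varphi$, or there are $\gamma_1,\dots,\gamma_k\in\Gamma$ ($k\ge 1$ finite) with $\vdash_{\mathbf{L}}(\gamma_1\land\dots\land\gamma_k)\to\varphi$. **Semantics.** Let $A=\{T,t,F\}$ with $T=(1,0)$, $t=(1,1)$, $F=(0,1)$; for $a\in A$ write $a=(a_1,a_2)$. Designated values: $\mathcal{D}=\{T,t\}$. Let $\sqcap,\sqcup,\supset,{\sim}$ be the Boolean meet, join, implication and complement on $\{0,1\}$, and $\bigwedge$ the meet of a non-empty subset. For $a,b\in A$, $\emptyset\neq X\subseteq A$: - $a\,\tilde\land\,b=\{c\in A: c_1=a_1\sqcap b_1\}$; $a\,\tilde\lor\,b=\{c\in A: c_1=a_1\sqcup b_1\}$; $a\,\tilde\to\,b=\{c\in A: c_1=a_1\supset b_1\}$; - $\tilde\neg a=\{c\in A: c_1=a_2\}$; $\tilde\neg_1 a=\{c\in A: c_1=a_2\text{ and }c_2\le a_1\}$; - $\tilde\circ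 a=\{c\in A: c_1\le{\sim}(a_1\sqcap a_2)\}$; $\tilde\circ_1 a=\{c\in A: c_1={\sim}(a_1\sqcap a_2)\}$; $\tilde\circ_2 a=\{({\sim}(a_1\sqcap a_2),\,a_1\sqcap a_2)\}$; - $\tilde{\mathsf{O}}(X)=\{c\in A: c_1=\bigwedge\{x_1:x\in X\}\}$. For each $\mathbf{L}$ the pair of multioperators interpreting $(\neg,\circ)$, denoted $(\tilde\neg^{\mathbf{L}},\tilde\circ^{\mathbf{L}})$, is: $(\tilde\neg,\tilde\circ_1)$ for $DmbCciw$; $(\tilde\neg,\tilde\circ_2)$ for $DmbCci$; $(\tilde\neg_1,\tilde\circ)$ for $DbC$; $(\tilde\neg_1,\tilde\circ_2)$ for $DCi$. A swap Kripke model for $\mathbf{L}$ is a triple $\langle W,R,\{v_w\}_{w\in W}\rangle$ where $W\ne\emptyset$, $R\subseteq W^2$ is serial (every $w$ has some $w'$ with $wRw'$), and each $v_w:For(\Sigma)\to A$ satisfies, for all $\alpha,\beta$: $v_w(\alpha\#\beta)\in v_w(\alpha)\,\tilde\#\,v_w(\beta)$ for $\#\in\{\land,\lor,\to\}$; $v_w(\neg\alpha)\in\tilde\neg^{\mathbf{L}} v_w(\alpha)$; $v_w(\circ\alpha)\in\tilde\circ^{\mathbf{L}} v_w(\alpha)$; $v_w(\mathsf{O}\alpha)\in\tilde{\mathsf{O}}(\{v_{w'}(\alpha): wRw'\})$. $\mathcal{M},w\vDash\alpha$ means $v_w(\alpha)\in\mathcal{D}$; $\mathcal{M},w\vDash\Gamma$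 means $\mathcal{M},w\vDash\gamma$ for all $\gamma\in\Gamma$. $\Gamma\vDash_{\mathbf{L}}\alpha$ means: for every swap Kripke model $\mathcal{M}$ for $\mathbf{L}$ and every world $w$ of it, $\mathcal{M},w\vDash\Gamma$ implies $\mathcal{M},w\vDash\alpha$. -}

module Defs where

open import Data.Bool using (Bool; true; false; _≤_)
  renaming (_∧_ to _⊓_; _∨_ to _⊔_; not to ∼_)
open import Data.List.NonEmpty using (List⁺; foldr₁)
open import Data.List.NonEmpty.Relation.Unary.All using (All)
open import Data.Nat using (ℕ)
open import Data.Product using (∃-syntax; _×_; _,_)
open import Data.Sum using (_⊎_)
open import Level using (0ℓ)
open import Relation.Binary using (Rel)
open import Relation.Binary.PropositionalEquality using (_≡_)
open import Relation.Unary using (Pred; _∈_; _∪_)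

------------------------------------------------------------------------
-- Formulas

infixr 5 _⇒_
infixr 6 _∨_
infixr 7 _∧_
infix  8 ¬_ O_ ∘_

data Formula : Set where
  var         : ℕ → Formula
  _⇒_ _∨_ _∧_ : Formula → Formula → Formula
  ¬_ O_ ∘_    : Formula → Formula

⊥[_] : Formula → Formula
⊥[ α ] = (α ∧ ¬ α) ∧ ∘ α

------------------------------------------------------------------------
-- Hilbert calculi

data CPL⁺ : Pred Formula 0ℓ where
  K   : ∀ α β → CPL⁺ (α ⇒ (β ⇒ α))
  S   : ∀ α β γ → CPL⁺ ((α ⇒ (β ⇒ γ)) ⇒ ((α ⇒ β) ⇒ (α ⇒ γ)))
  ∧I  : ∀ α β → CPL⁺ (α ⇒ (β ⇒ (α ∧ β)))
  ∧E₁ : ∀ α β → CPL⁺ ((α ∧ β) ⇒ α)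
  ∧E₂ : ∀ α β → CPL⁺ ((α ∧ β) ⇒ β)
  ∨I₁ : ∀ α β → CPL⁺ (α ⇒ (α ∨ β))
  ∨I₂ : ∀ α β → CPL⁺ (β ⇒ (α ∨ β))
  ∨E  : ∀ α β γ → CPL⁺ ((α ⇒ γ) ⇒ ((β ⇒ γ) ⇒ ((α ∨ β) ⇒ γ)))
  ∨⇒  : ∀ α β → CPL⁺ (α ∨ (α ⇒ β))

data DmbC : Pred Formula 0ℓ where
  cpl⁺ : ∀ {α} → CPL⁺ α → DmbC α
  EM   : ∀ α → DmbC (α ∨ ¬ α)
  bc   : ∀ α β → DmbC (∘ α ⇒ (α ⇒ (¬ α ⇒ β)))
  O-K  : ∀ α β → DmbC (O (α ⇒ β) ⇒ (O α ⇒ O β))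
  O-E  : ∀ α → DmbC (O ⊥[ α ] ⇒ ⊥[ α ])

data Ciw : Pred Formula 0ℓ where
  ciw : ∀ α → Ciw (∘ α ∨ (α ∧ ¬ α))

data Ci : Pred Formula 0ℓ where
  ci : ∀ α → Ci (¬ ∘ α ⇒ (α ∧ ¬ α))

data Cf : Pred Formula 0ℓ where
  cf : ∀ α → Cf (¬ ¬ α ⇒ α)

data Logic : Set where
  DmbCciw DmbCci DbC DCi : Logic

Axiom : Logic → Pred Formula 0ℓ
Axiom DmbCciw = DmbC ∪ Ciw
Axiom DmbCci  = DmbC ∪ Ci
Axiom DbC     = DmbC ∪ Cf
Axiom DCi     = (DmbC ∪ Ci) ∪ Cf

infix 2 ⊢[_]_ _⊢[_]_ _⊨[_]_

data ⊢[_]_ (L : Logic) : Formula → Set where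
  axiom : ∀ {φ} → φ ∈ Axiom L → ⊢[ L ] φ
  MP    : ∀ {φ ψ} → ⊢[ L ] φ ⇒ ψ → ⊢[ L ] φ → ⊢[ L ] ψ
  O-nec : ∀ {φ} → ⊢[ L ] φ → ⊢[ L ] O φ

⋀ : List⁺ Formula → Formula
⋀ = foldr₁ _∧_

_⊢[_]_ : Pred Formula 0ℓ → Logic → Formula → Set
Γ ⊢[ L ] φ = (⊢[ L ] φ) ⊎ (∃[ γs ] All Γ γs × (⊢[ L ] ⋀ γs ⇒ φ))

------------------------------------------------------------------------
-- Truth values and multioperators

data A : Set where
  T t F : A

-- T = (1,0), t = (1,1), F = (0,1).
π₁ π₂ : A → Bool
π₁ T = true
π₁ t = true
π₁ F = false
π₂ T = false
π₂ t = true
π₂ F = true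

data Designated : Pred A 0ℓ where
  T : Designated T
  t : Designated t

_⊃_ : Bool → Bool → Bool
x ⊃ y = ∼ x ⊔ y

-- Without excluded middle the meet of an arbitrary set of Booleans need not
-- be computable, so it is given as a relation: b is the greatest lower bound.
IsMeet : Pred Bool 0ℓ → Pred Bool 0ℓ
IsMeet X b = (∀ x → x ∈ X → b ≤ x) × (∀ c → (∀ x → x ∈ X → c ≤ x) → c ≤ b)

_∧~_ _∨~_ _⇒~_ : A → A → Pred A 0ℓ
(a ∧~ b) c = π₁ c ≡ π₁ a ⊓ π₁ b
(a ∨~ b) c = π₁ c ≡ π₁ a ⊔ π₁ b
(a ⇒~ b) c = π₁ c ≡ π₁ a ⊃ π₁ b

¬~ ¬~₁ ∘~ ∘~₁ ∘~₂ : A → Pred A 0ℓ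
¬~  a c = π₁ c ≡ π₂ a
¬~₁ a c = π₁ c ≡ π₂ a × π₂ c ≤ π₁ a
∘~  a c = π₁ c ≤ ∼ (π₁ a ⊓ π₂ a)
∘~₁ a c = π₁ c ≡ ∼ (π₁ a ⊓ π₂ a)
∘~₂ a c = (π₁ c , π₂ c) ≡ (∼ (π₁ a ⊓ π₂ a) , π₁ a ⊓ π₂ a)

-- Only ever applied to nonempty X, by seriality of accessibility relations.
O~ : Pred A 0ℓ → Pred A 0ℓ
O~ X c = IsMeet (λ b → ∃[ x ] x ∈ X × π₁ x ≡ b) (π₁ c)

¬~[_] ∘~[_] : Logic → A → Pred A 0ℓ
¬~[ DmbCciw ] = ¬~
¬~[ DmbCci  ] = ¬~
¬~[ DbC     ] = ¬~₁
¬~[ DCi     ] = ¬~₁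
∘~[ DmbCciw ] = ∘~₁
∘~[ DmbCci  ] = ∘~₂
∘~[ DbC     ] = ∘~
∘~[ DCi     ] = ∘~₂

------------------------------------------------------------------------
-- Swap Kripke models

record Model (L : Logic) : Set₁ where
  field
    W        : Set
    nonempty : W
    R        : Rel W 0ℓ
    serial   : ∀ w → ∃[ w′ ] R w w′
    v        : W → Formula → A
    v-∧      : ∀ w α β → v w (α ∧ β) ∈ (v w α ∧~ v w β)
    v-∨      : ∀ w α β → v w (α ∨ β) ∈ (v w α ∨~ v w β)
    v-⇒      : ∀ w α β → v w (α ⇒ β) ∈ (v w α ⇒~ v w β)
    v-¬      : ∀ w α → v w (¬ α) ∈ ¬~[ L ] (v w α)
    v-∘      : ∀ w α → v w (∘ α) ∈ ∘~[ L ] (v w α)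
    v-O      : ∀ w α → v w (O α) ∈ O~ (λ a → ∃[ w′ ] R w w′ × v w′ α ≡ a)

infix 2 _,_⊨_ _,_⊨*_

_,_⊨_ : ∀ {L} (M : Model L) → Model.W M → Formula → Set
M , w ⊨ α = Designated (Model.v M w α)

_,_⊨*_ : ∀ {L} (M : Model L) → Model.W M → Pred Formula 0ℓ → Set
M , w ⊨* Γ = ∀ γ → γ ∈ Γ → M , w ⊨ γ

_⊨[_]_ : Pred Formula 0ℓ → Logic → Formula → Set₁
Γ ⊨[ L ] α = (M : Model L) (w : Model.W M) → M , w ⊨* Γ → M , w ⊨ α

{-# OPTIONS --safe #-}

-- Henkin's canonical model.  A world is a Boolean valuation making all theorems
-- true, commuting with ⇒ and refuting some formula, i.e. the characteristic
-- function of a nontrivial prime theory.  The swap value of α at a world is the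
-- snapshot (α , ¬ α), and each axiom schema of L becomes the Boolean condition
-- that the matching multioperator imposes on snapshots.  A world sees those that
-- satisfy everything it declares obligatory; O-E makes this relation serial.
module Submission where

open import Defs
open import Axiom.ExcludedMiddle using (ExcludedMiddle)
open import Data.Bool using (Bool; true; false; _≤_; b≤b)
  renaming (_∧_ to _⊓_; _∨_ to _⊔_; not to ∼_)
open import Data.Bool.Properties using (≤-minimum; ≤-reflexive)
open import Data.Empty using (⊥; ⊥-elim)
open import Data.List using (List; []; _∷_; _++_; concatMap)
open import Data.List.Membership.Propositional using (lose) renaming (_∈_ to _∈ˡ_)
open import Data.List.Membership.Propositional.Properties using (∈-++⁺ˡ; ∈-++⁺ʳ; ∈-concatMap⁺)
open import Data.List.NonEmpty using (_∷_)
open import Data.List.NonEmpty.Relation.Unary.All using (_∷_)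
open import Data.List.Relation.Unary.All using (All; []; _∷_)
open import Data.List.Relation.Unary.All.Properties using (++⁺)
open import Data.List.Relation.Unary.Any using (here; there)
open import Data.Nat using (ℕ; zero; suc; _≤′_; ≤′-refl; ≤′-step) renaming (_⊔_ to _⊔ⁿ_)
open import Data.Nat.Properties using (m≤m⊔n; m≤n⊔m; ≤⇒≤′)
open import Data.Product using (∃-syntax; _×_; _,_)
open import Data.Sum using (_⊎_; inj₁; inj₂; map₁)
open import Level using (0ℓ)
open import Relation.Binary.PropositionalEquality using (_≡_; refl; sym; trans; cong)
open import Relation.Nullary.Decidable using (yes; no; does; dec-true; dec-false; decidable-stable)
open import Relation.Unary using (Pred; _∈_; _∉_; _∪_; _⊆_; ｛_｝; ∅)

ascend : ∀ {X : Set} {P : ℕ → Pred X 0ℓ} → (∀ n → P n ⊆ P (suc n)) →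
         ∀ {m n} → m ≤′ n → P m ⊆ P n
ascend step ≤′-refl         p = p
ascend step (≤′-step {n} le) p = step n (ascend step le p)

-- Enumeration of formulas

binaries : Formula → Formula → List Formula
binaries α β = (α ⇒ β) ∷ (α ∨ β) ∷ (α ∧ β) ∷ []

compounds : List Formula → Formula → List Formula
compounds αs α = ¬ α ∷ O α ∷ ∘ α ∷ concatMap (binaries α) αs

-- An increasing chain of finite lists takes the place of an enumeration by single indices:
-- Lindenbaum's construction asks only that every formula occur at some level.
level : ℕ → List Formula
level zero    = []
level (suc n) = var n ∷ level n ++ concatMap (compounds (level n)) (level n)

level-mono : ∀ {m n α} → m ≤′ n → α ∈ˡ level m → α ∈ˡ level n
level-mono m≤n = ascend {P = λ n → _∈ˡ level n} (λ n α∈ → there (∈-++⁺ˡ α∈)) m≤n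

compound∈level : ∀ n {α β} → α ∈ˡ level n → β ∈ˡ compounds (level n) α → β ∈ˡ level (suc n)
compound∈level n α∈ β∈ = there (∈-++⁺ʳ (level n) (∈-concatMap⁺ _ (lose α∈ β∈)))

binary∈level : ∀ {α β γ} → ∃[ m ] α ∈ˡ level m → ∃[ n ] β ∈ˡ level n →
               γ ∈ˡ binaries α β → ∃[ k ] γ ∈ˡ level k
binary∈level (m , α∈) (n , β∈) γ∈ = suc (m ⊔ⁿ n) ,
  compound∈level (m ⊔ⁿ n) (level-mono (≤⇒≤′ (m≤m⊔n m n)) α∈)
    -- The three `there` skip the unary compounds of `α`.
    (there (there (there (∈-concatMap⁺ _ (lose (level-mono (≤⇒≤′ (m≤n⊔m m n)) β∈) γ∈)))))

level-exhausts : ∀ α → ∃[ n ] α ∈ˡ level n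
level-exhausts (var n) = suc n , here refl
level-exhausts (α ⇒ β) = binary∈level (level-exhausts α) (level-exhausts β) (here refl)
level-exhausts (α ∨ β) = binary∈level (level-exhausts α) (level-exhausts β) (there (here refl))
level-exhausts (α ∧ β) = binary∈level (level-exhausts α) (level-exhausts β) (there (there (here refl)))
level-exhausts (¬ α) with n , α∈ ← level-exhausts α = suc n , compound∈level n α∈ (here refl)
level-exhausts (O α) with n , α∈ ← level-exhausts α = suc n , compound∈level n α∈ (there (here refl))
level-exhausts (∘ α) with n , α∈ ← level-exhausts α = suc n , compound∈level n α∈ (there (there (here refl)))

-- Local derivability

DmbC⊆Axiom : ∀ L → DmbC ⊆ Axiom L
DmbC⊆Axiom DmbCciw a = inj₁ a
DmbC⊆Axiom DmbCci  a = inj₁ a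
DmbC⊆Axiom DbC     a = inj₁ a
DmbC⊆Axiom DCi     a = inj₁ (inj₁ a)

module _ {L : Logic} where

  dmbc : ∀ {α} → DmbC α → ⊢[ L ] α
  dmbc a = axiom (DmbC⊆Axiom L a)

  pos : ∀ {α} → CPL⁺ α → ⊢[ L ] α
  pos a = dmbc (cpl⁺ a)

  ⇒-refl : ∀ α → ⊢[ L ] α ⇒ α
  ⇒-refl α = MP (MP (pos (S α (α ⇒ α) α)) (pos (K α (α ⇒ α)))) (pos (K α α))

infix 2 _⊩[_]_
-- Hypotheses are combined by modus ponens only; necessitation stays inside `thm`. This is what
-- makes the deduction theorem hold.
data _⊩[_]_ (Γ : Pred Formula 0ℓ) (L : Logic) : Formula → Set where
  thm : ∀ {α} → ⊢[ L ] α → Γ ⊩[ L ] α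
  hyp : ∀ {α} → α ∈ Γ → Γ ⊩[ L ] α
  mp  : ∀ {α β} → Γ ⊩[ L ] α ⇒ β → Γ ⊩[ L ] α → Γ ⊩[ L ] β

module _ {L : Logic} where

  cut : ∀ {Γ Δ} → (∀ {γ} → γ ∈ Γ → Δ ⊩[ L ] γ) → ∀ {α} → Γ ⊩[ L ] α → Δ ⊩[ L ] α
  cut σ (thm d)  = thm d
  cut σ (hyp γ)  = σ γ
  cut σ (mp d e) = mp (cut σ d) (cut σ e)

  weaken : ∀ {Γ Δ} → Γ ⊆ Δ → ∀ {α} → Γ ⊩[ L ] α → Δ ⊩[ L ] α
  weaken Γ⊆Δ = cut (λ γ → hyp (Γ⊆Δ γ))

  deduction : ∀ {Γ α β} → Γ ∪ ｛ α ｝ ⊩[ L ] β → Γ ⊩[ L ] α ⇒ β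
  deduction (thm d)           = thm (MP (pos (K _ _)) d)
  deduction (hyp (inj₁ γ))    = mp (thm (pos (K _ _))) (hyp γ)
  deduction (hyp (inj₂ refl)) = thm (⇒-refl _)
  deduction (mp d e)          = mp (mp (thm (pos (S _ _ _))) (deduction d)) (deduction e)

  ∅⊩⇒⊢ : ∀ {α} → ∅ ⊩[ L ] α → ⊢[ L ] α
  ∅⊩⇒⊢ (thm d)  = d
  ∅⊩⇒⊢ (mp d e) = MP (∅⊩⇒⊢ d) (∅⊩⇒⊢ e)

  compactness : ∀ {Γ α} → Γ ⊩[ L ] α → ∃[ γs ] All Γ γs × ((_∈ˡ γs) ⊩[ L ] α)
  compactness (thm d) = [] , [] , thm d
  compactness (hyp γ) = _ ∷ [] , γ ∷ [] , hyp (here refl)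
  compactness (mp d e)
    with γs , Γγs , d′ ← compactness d | δs , Γδs , e′ ← compactness e =
    γs ++ δs , ++⁺ Γγs Γδs , mp (weaken ∈-++⁺ˡ d′) (weaken (∈-++⁺ʳ γs) e′)

  ⋀⊩conjunct : ∀ γ γs {α} → α ∈ˡ γ ∷ γs → ｛ ⋀ (γ ∷ γs) ｝ ⊩[ L ] α
  ⋀⊩conjunct γ []       (here refl) = hyp refl
  ⋀⊩conjunct γ (δ ∷ δs) (here refl) = mp (thm (pos (∧E₁ _ _))) (hyp refl)
  ⋀⊩conjunct γ (δ ∷ δs) (there α∈)  =
    cut (λ { refl → mp (thm (pos (∧E₂ γ _))) (hyp refl) }) (⋀⊩conjunct δ δs α∈)

  -- `⋀` takes a nonempty list, so a derivation whose list of used hypotheses is empty falls under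
  -- the first alternative of `_⊢[_]_`.
  ⊩⇒⊢ : ∀ {Γ α} → Γ ⊩[ L ] α → Γ ⊢[ L ] α
  ⊩⇒⊢ d with compactness d
  ... | []     , _        , d′ = inj₁ (∅⊩⇒⊢ (weaken (λ ()) d′))
  ... | γ ∷ γs , Γγ ∷ Γγs , d′ = inj₂ (γ ∷ γs , Γγ ∷ Γγs ,
    ∅⊩⇒⊢ (deduction (weaken inj₂ (cut (⋀⊩conjunct γ γs) d′))))

-- A Boolean-valued `holds` keeps `World L` in `Set`, as the field `W` of `Model` demands; theories
-- given as predicates would lie in `Set₁`.
record World (L : Logic) : Set where
  field
    holds      : Formula → Bool
    holds-thm  : ∀ {α} → ⊢[ L ] α → holds α ≡ true
    holds-⇒    : ∀ α β → holds (α ⇒ β) ≡ holds α ⊃ holds β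
    nontrivial : ∃[ α ] holds α ≡ false

open World

-- Lindenbaum's lemma

module Lindenbaum (em : ExcludedMiddle 0ℓ) {L : Logic} (φ : Formula) where

  -- φ stays underivable constructively: a derivation of φ from add Δ α is in
  -- particular one from Δ ∪ ｛ α ｝, so α has not been added after all.
  add : Pred Formula 0ℓ → Formula → Pred Formula 0ℓ
  add Δ α β = Δ β ⊎ (α ≡ β × ((Δ ∪ ｛ α ｝ ⊩[ L ] φ) → ⊥))

  add-⊮ : ∀ {Δ α} → φ ∉ (Δ ⊩[ L ]_) → φ ∉ (add Δ α ⊩[ L ]_)
  add-⊮ Δ⊮φ d = Δ⊮φ (weaken (λ { (inj₁ δ) → δ ; (inj₂ (refl , ¬d)) → ⊥-elim (¬d d′) }) d)
    where d′ = weaken (λ { (inj₁ δ) → inj₁ δ ; (inj₂ (refl , _)) → inj₂ refl }) d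

  -- Unlike `α ∉ Δ`, the second alternative survives enlarging `Δ`, so a decision taken at one stage
  -- persists in the limit.
  Decides : Pred Formula 0ℓ → Pred Formula 0ℓ
  Decides Δ α = α ∈ Δ ⊎ (Δ ∪ ｛ α ｝ ⊩[ L ] φ)

  decides-mono : ∀ {Γ Δ} → Γ ⊆ Δ → Decides Γ ⊆ Decides Δ
  decides-mono Γ⊆Δ (inj₁ α∈) = inj₁ (Γ⊆Δ α∈)
  decides-mono Γ⊆Δ (inj₂ d)  = inj₂ (weaken (map₁ Γ⊆Δ) d)

  -- `add` builds its condition in without deciding it; excluded middle decides it here.
  add-decides : ∀ Δ α → α ∈ Decides (add Δ α)
  add-decides Δ α with em {Δ ∪ ｛ α ｝ ⊩[ L ] φ}
  ... | yes d = inj₂ (weaken (map₁ inj₁) d)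
  ... | no ¬d = inj₁ (inj₂ (refl , ¬d))

  extend : Pred Formula 0ℓ → List Formula → Pred Formula 0ℓ
  extend Δ []       = Δ
  extend Δ (α ∷ αs) = extend (add Δ α) αs

  extend-⊇ : ∀ {Δ} αs → Δ ⊆ extend Δ αs
  extend-⊇ []       δ = δ
  extend-⊇ (α ∷ αs) δ = extend-⊇ αs (inj₁ δ)

  extend-⊮ : ∀ {Δ} αs → φ ∉ (Δ ⊩[ L ]_) → φ ∉ (extend Δ αs ⊩[ L ]_)
  extend-⊮ []       Δ⊮φ = Δ⊮φ
  extend-⊮ (α ∷ αs) Δ⊮φ = extend-⊮ αs (add-⊮ Δ⊮φ)

  extend-decides : ∀ {Δ α} αs → α ∈ˡ αs → α ∈ Decides (extend Δ αs)
  extend-decides (α ∷ αs) (here refl) = decides-mono (extend-⊇ αs) (add-decides _ α)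
  extend-decides (α ∷ αs) (there α∈)  = extend-decides αs α∈

  module _ (Γ : Pred Formula 0ℓ) (Γ⊮φ : φ ∉ (Γ ⊩[ L ]_)) where

    stage : ℕ → Pred Formula 0ℓ
    stage zero    = Γ
    stage (suc n) = extend (stage n) (level n)

    stage-mono : ∀ {m n} → m ≤′ n → stage m ⊆ stage n
    stage-mono m≤n = ascend {P = stage} (λ n → extend-⊇ (level n)) m≤n

    stage-⊮ : ∀ n → φ ∉ (stage n ⊩[ L ]_)
    stage-⊮ zero    = Γ⊮φ
    stage-⊮ (suc n) = extend-⊮ (level n) (stage-⊮ n)

    limit : Pred Formula 0ℓ
    limit α = ∃[ n ] α ∈ stage n

    -- A derivation uses finitely many hypotheses, and the stages form a chain.
    limit⊩⇒stage⊩ : ∀ {α} → limit ⊩[ L ] α → ∃[ n ] (stage n ⊩[ L ] α)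
    limit⊩⇒stage⊩ (thm d)       = zero , thm d
    limit⊩⇒stage⊩ (hyp (n , α∈)) = n , hyp α∈
    limit⊩⇒stage⊩ (mp d e)
      with m , d′ ← limit⊩⇒stage⊩ d | n , e′ ← limit⊩⇒stage⊩ e =
      m ⊔ⁿ n , mp (weaken (stage-mono (≤⇒≤′ (m≤m⊔n m n))) d′)
                  (weaken (stage-mono (≤⇒≤′ (m≤n⊔m m n))) e′)

    limit-⊮ : φ ∉ (limit ⊩[ L ]_)
    limit-⊮ d with n , d′ ← limit⊩⇒stage⊩ d = stage-⊮ n d′

    -- `α` lies in some `level n`, so stage `suc n` decides it, and the decision carries over to the
    -- limit.
    limit-maximal : ∀ {α} → α ∉ limit → limit ∪ ｛ α ｝ ⊩[ L ] φ
    limit-maximal {α} α∉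
      with n , α∈ ← level-exhausts α
      with decides-mono (suc n ,_) (extend-decides (level n) α∈)
    ... | inj₁ α∈limit = ⊥-elim (α∉ α∈limit)
    ... | inj₂ d       = d

    -- Were `α` missing, maximality and deduction would give `α ⇒ φ`, and hence `φ`, from the limit.
    limit-closed : ∀ {α} → limit ⊩[ L ] α → α ∈ limit
    limit-closed d = decidable-stable em
      (λ α∉ → limit-⊮ (mp (deduction (limit-maximal α∉)) d))

    -- If `α ⇒ β` were missing as well, each of the two would lead to `φ`, and `∨E` applied to the
    -- axiom `α ∨ (α ⇒ β)` would derive `φ`.
    limit-⇒ : ∀ {α} β → α ∉ limit → α ⇒ β ∈ limit
    limit-⇒ β α∉ = decidable-stable em (λ α⇒β∉ → limit-⊮
      (mp (mp (mp (thm (pos (∨E _ _ _))) (deduction (limit-maximal α∉)))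
              (deduction (limit-maximal α⇒β∉)))
          (thm (pos (∨⇒ _ β)))))

    maximal : World L
    maximal .holds α       = does (em {α ∈ limit})
    maximal .holds-thm d   = dec-true em (limit-closed (thm d))
    maximal .holds-⇒ α β with em {α ∈ limit} | em {β ∈ limit}
    ... | no α∉  | _      = dec-true em (limit-⇒ β α∉)
    ... | yes _  | yes β∈ = dec-true em (limit-closed (mp (thm (pos (K _ _))) (hyp β∈)))
    ... | yes α∈ | no β∉  = dec-false em (λ α⇒β∈ → β∉ (limit-closed (mp (hyp α⇒β∈) (hyp α∈))))
    maximal .nontrivial    = φ , dec-false em (λ φ∈ → limit-⊮ (hyp φ∈))

    lindenbaum : ∃[ w ] (∀ {γ} → γ ∈ Γ → holds w γ ≡ true) × holds w φ ≡ false
    lindenbaum = maximal , (λ γ∈ → dec-true em (zero , γ∈)) ,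
                 dec-false em (λ φ∈ → limit-⊮ (hyp φ∈))

open Lindenbaum using (lindenbaum)

-- Boolean content of the axiom schemas

⊃-elim : ∀ {x y} → x ⊃ y ≡ true → x ≡ true → y ≡ true
⊃-elim p refl = p

⊓-unique : ∀ x y z → x ⊃ (y ⊃ z) ≡ true → z ⊃ x ≡ true → z ⊃ y ≡ true → z ≡ x ⊓ y
⊓-unique true  true  z     i _ _ = i
⊓-unique true  false false _ _ _ = refl
⊓-unique false y     false _ _ _ = refl

-- The third hypothesis is `∨E` with conclusion `α` once `α ⇒ α` is discharged; it settles the case
-- where both disjuncts fail.
⊔-unique : ∀ x y z → x ⊃ z ≡ true → y ⊃ z ≡ true → (y ⊃ x) ⊃ (z ⊃ x) ≡ true → z ≡ x ⊔ y
⊔-unique true  y     z     i _ _ = i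
⊔-unique false true  z     _ j _ = j
⊔-unique false false false _ _ _ = refl

⊃⇒≤ : ∀ x y → x ⊃ y ≡ true → x ≤ y
⊃⇒≤ true  true _ = b≤b
⊃⇒≤ false y    _ = ≤-minimum y

exclusion : ∀ c x y → c ⊃ (x ⊃ (y ⊃ false)) ≡ true → c ≤ ∼ (x ⊓ y)
exclusion false x     y     _ = ≤-minimum _
exclusion true  true  false _ = b≤b
exclusion true  false y     _ = b≤b

complement : ∀ c z → c ≤ ∼ z → c ⊔ z ≡ true → c ≡ ∼ z
complement true  false _ _ = refl
complement false true  _ _ = refl

-- If `z` is true, the bound makes `c` false and the disjunction forces `n`; otherwise the
-- implication makes `n` false and the disjunction forces `c`.
complement₂ : ∀ c n z → c ≤ ∼ z → c ⊔ n ≡ true → n ⊃ z ≡ true → (c , n) ≡ (∼ z , z)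
complement₂ true  true  true () _ _
complement₂ true  false false _ _ _ = refl
complement₂ false true  true  _ _ _ = refl

-- Truth conditions at a world

module _ {L : Logic} (w : World L) where

  private
    ∣_∣ : Formula → Bool
    ∣_∣ = holds w

  holds⊃ : ∀ {α β} → ⊢[ L ] α ⇒ β → ∣ α ∣ ⊃ ∣ β ∣ ≡ true
  holds⊃ d = trans (sym (holds-⇒ w _ _)) (holds-thm w d)

  holds⊃⊃ : ∀ {α β γ} → ⊢[ L ] α ⇒ (β ⇒ γ) → ∣ α ∣ ⊃ (∣ β ∣ ⊃ ∣ γ ∣) ≡ true
  holds⊃⊃ {α} d = trans (cong (∣ α ∣ ⊃_) (sym (holds-⇒ w _ _))) (holds⊃ d)

  holds-mp : ∀ {α β} → ∣ α ⇒ β ∣ ≡ true → ∣ α ∣ ≡ true → ∣ β ∣ ≡ true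
  holds-mp p = ⊃-elim (trans (sym (holds-⇒ w _ _)) p)

  holds-∧ : ∀ α β → ∣ α ∧ β ∣ ≡ ∣ α ∣ ⊓ ∣ β ∣
  holds-∧ α β = ⊓-unique _ _ _ (holds⊃⊃ (pos (∧I α β))) (holds⊃ (pos (∧E₁ α β))) (holds⊃ (pos (∧E₂ α β)))

  holds-∨ : ∀ α β → ∣ α ∨ β ∣ ≡ ∣ α ∣ ⊔ ∣ β ∣
  holds-∨ α β = ⊔-unique _ _ _ (holds⊃ (pos (∨I₁ α β))) (holds⊃ (pos (∨I₂ α β)))
    (trans (cong (_⊃ (∣ α ∨ β ∣ ⊃ ∣ α ∣)) (sym (holds-⇒ w β α))) (holds⊃⊃ (MP (pos (∨E α β α)) (⇒-refl α))))

  holds-¬-total : ∀ α → ∣ α ∣ ⊔ ∣ ¬ α ∣ ≡ true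
  holds-¬-total α = trans (sym (holds-∨ α (¬ α))) (holds-thm w (dmbc (EM α)))

  -- Assuming only that `L` contains the schema lets one proof serve both `DbC` and `DCi`.
  holds-¬¬ : Cf ⊆ Axiom L → ∀ α → ∣ ¬ ¬ α ∣ ≤ ∣ α ∣
  holds-¬¬ Cf⊆ α = ⊃⇒≤ _ _ (holds⊃ (axiom (Cf⊆ (cf α))))

  -- Instantiating `bc` with a formula refuted at `w` turns explosion into exclusion.
  holds-∘-≤ : ∀ α → ∣ ∘ α ∣ ≤ ∼ (∣ α ∣ ⊓ ∣ ¬ α ∣)
  holds-∘-≤ α with φ , φ≡false ← nontrivial w = exclusion (∣ ∘ α ∣) (∣ α ∣) (∣ ¬ α ∣)
    (trans (cong (λ b → ∣ ∘ α ∣ ⊃ (∣ α ∣ ⊃ (∣ ¬ α ∣ ⊃ b))) (sym φ≡false))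
      (trans (cong (λ b → ∣ ∘ α ∣ ⊃ (∣ α ∣ ⊃ b)) (sym (holds-⇒ w _ _)))
        (holds⊃⊃ (dmbc (bc α φ)))))

  holds-∘ : Ciw ⊆ Axiom L → ∀ α → ∣ ∘ α ∣ ≡ ∼ (∣ α ∣ ⊓ ∣ ¬ α ∣)
  holds-∘ Ciw⊆ α = complement _ _ (holds-∘-≤ α)
    (trans (cong (∣ ∘ α ∣ ⊔_) (sym (holds-∧ α (¬ α))))
      (trans (sym (holds-∨ _ _)) (holds-thm w (axiom (Ciw⊆ (ciw α))))))

  holds-∘-¬∘ : Ci ⊆ Axiom L → ∀ α →
               (∣ ∘ α ∣ , ∣ ¬ ∘ α ∣) ≡ (∼ (∣ α ∣ ⊓ ∣ ¬ α ∣) , ∣ α ∣ ⊓ ∣ ¬ α ∣)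
  holds-∘-¬∘ Ci⊆ α = complement₂ _ _ _ (holds-∘-≤ α) (holds-¬-total (∘ α))
    (trans (cong (∣ ¬ ∘ α ∣ ⊃_) (sym (holds-∧ α (¬ α)))) (holds⊃ (axiom (Ci⊆ (ci α)))))

  holds-⊥ : ∀ α → ∣ ⊥[ α ] ∣ ≡ false
  holds-⊥ α = trans (holds-∧ _ _) (trans (cong (_⊓ ∣ ∘ α ∣) (holds-∧ _ _)) (disjoint _ _ (holds-∘-≤ α)))
    where
    disjoint : ∀ x c → c ≤ ∼ x → x ⊓ c ≡ false
    disjoint true  false _ = refl
    disjoint false c     _ = refl

  Obligatory : Pred Formula 0ℓ
  Obligatory α = ∣ O α ∣ ≡ true

  -- Necessitation handles theorems and `O-K` handles modus ponens.
  obligatory-closed : ∀ {α} → Obligatory ⊩[ L ] α → α ∈ Obligatory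
  obligatory-closed (thm d)  = holds-thm w (O-nec d)
  obligatory-closed (hyp α)  = α
  obligatory-closed (mp d e) =
    holds-mp (holds-mp (holds-thm w (dmbc (O-K _ _))) (obligatory-closed d)) (obligatory-closed e)

-- The canonical model

snapshot : Bool → Bool → A
snapshot true  false = T
snapshot true  true  = t
snapshot false _     = F

π₁-snapshot : ∀ x y → π₁ (snapshot x y) ≡ x
π₁-snapshot true  true  = refl
π₁-snapshot true  false = refl
π₁-snapshot false _     = refl

-- The pair (false , false) is no truth value; α ∨ ¬ α keeps it from arising.
π₂-snapshot : ∀ x y → x ⊔ y ≡ true → π₂ (snapshot x y) ≡ y
π₂-snapshot true  true  _ = refl
π₂-snapshot true  false _ = refl
π₂-snapshot false true  _ = refl

designated⇒π₁ : ∀ {a} → Designated a → π₁ a ≡ true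
designated⇒π₁ T = refl
designated⇒π₁ t = refl

π₁⇒designated : ∀ {a} → π₁ a ≡ true → Designated a
π₁⇒designated {T} _ = T
π₁⇒designated {t} _ = t

module _ {L : Logic} (w : World L) where

  value : Formula → A
  value α = snapshot (holds w α) (holds w (¬ α))

  π₁-value : ∀ α → π₁ (value α) ≡ holds w α
  π₁-value α = π₁-snapshot _ _

  π₂-value : ∀ α → π₂ (value α) ≡ holds w (¬ α)
  π₂-value α = π₂-snapshot _ _ (holds-¬-total w α)

  value-∧ : ∀ α β → value (α ∧ β) ∈ (value α ∧~ value β)
  value-∧ α β rewrite π₁-value (α ∧ β) | π₁-value α | π₁-value β = holds-∧ w α β

  value-∨ : ∀ α β → value (α ∨ β) ∈ (value α ∨~ value β)
  value-∨ α β rewrite π₁-value (α ∨ β) | π₁-value α | π₁-value β = holds-∨ w α β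

  value-⇒ : ∀ α β → value (α ⇒ β) ∈ (value α ⇒~ value β)
  value-⇒ α β rewrite π₁-value (α ⇒ β) | π₁-value α | π₁-value β = holds-⇒ w α β

  value-¬~ : ∀ α → value (¬ α) ∈ ¬~ (value α)
  value-¬~ α = trans (π₁-value (¬ α)) (sym (π₂-value α))

  value-¬~₁ : Cf ⊆ Axiom L → ∀ α → value (¬ α) ∈ ¬~₁ (value α)
  value-¬~₁ Cf⊆ α = value-¬~ α , ≤-half
    where
    ≤-half : π₂ (value (¬ α)) ≤ π₁ (value α)
    ≤-half rewrite π₂-value (¬ α) | π₁-value α = holds-¬¬ w Cf⊆ α

  value-∘~ : ∀ α → value (∘ α) ∈ ∘~ (value α)
  value-∘~ α rewrite π₁-value (∘ α) | π₁-value α | π₂-value α = holds-∘-≤ w α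

  value-∘~₁ : Ciw ⊆ Axiom L → ∀ α → value (∘ α) ∈ ∘~₁ (value α)
  value-∘~₁ Ciw⊆ α rewrite π₁-value (∘ α) | π₁-value α | π₂-value α = holds-∘ w Ciw⊆ α

  value-∘~₂ : Ci ⊆ Axiom L → ∀ α → value (∘ α) ∈ ∘~₂ (value α)
  value-∘~₂ Ci⊆ α rewrite π₁-value (∘ α) | π₂-value (∘ α) | π₁-value α | π₂-value α = holds-∘-¬∘ w Ci⊆ α

value-¬ : ∀ L (w : World L) α → value w (¬ α) ∈ ¬~[ L ] (value w α)
value-¬ DmbCciw w = value-¬~ w
value-¬ DmbCci  w = value-¬~ w
value-¬ DbC     w = value-¬~₁ w inj₂
value-¬ DCi     w = value-¬~₁ w inj₂

value-∘ : ∀ L (w : World L) α → value w (∘ α) ∈ ∘~[ L ] (value w α)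
value-∘ DmbCciw w = value-∘~₁ w inj₂
value-∘ DmbCci  w = value-∘~₂ w inj₂
value-∘ DbC     w = value-∘~ w
value-∘ DCi     w = value-∘~₂ w (λ a → inj₁ (inj₂ a))

-- Accessibility and the clause for `O`

module _ (em : ExcludedMiddle 0ℓ) {L : Logic} where

  _sees_ : World L → World L → Set
  w sees w′ = ∀ {α} → α ∈ Obligatory w → holds w′ α ≡ true

  -- The obligations of `w` are closed under derivability, so they do not derive `α`, and
  -- Lindenbaum's lemma extends them to a world refuting it.
  sees-witness : ∀ w {α} → α ∉ Obligatory w → ∃[ w′ ] (w sees w′) × holds w′ α ≡ false
  sees-witness w {α} α∉ = lindenbaum em α (Obligatory w) (λ d → α∉ (obligatory-closed w d))

  sees-serial : ∀ w → ∃[ w′ ] w sees w′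
  sees-serial w = let w′ , sees , _ = sees-witness w ⊥∉ in w′ , sees
    where
    ⊥∉ : ⊥[ var 0 ] ∉ Obligatory w
    -- `O-E` would make the falsum true at `w`, which `holds-⊥` rules out; the choice of `var 0` is
    -- arbitrary.
    ⊥∉ O⊥ with () ← trans (sym (holds-⊥ w (var 0))) (holds-mp w (holds-thm w (dmbc (O-E _))) O⊥)

  holds-O-greatest : ∀ w α → (∀ w′ → w sees w′ → holds w′ α ≡ true) → α ∈ Obligatory w
  holds-O-greatest w α all = decidable-stable em λ α∉ →
    let w′ , sees , α≡false = sees-witness w α∉ in
    false≢true (trans (sym α≡false) (all w′ sees))
    where
    false≢true : false ≡ true → ⊥
    false≢true ()

  value-O : ∀ w α → value w (O α) ∈ O~ (λ a → ∃[ w′ ] (w sees w′) × value w′ α ≡ a)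
  value-O w α rewrite π₁-value w (O α) = lower , greatest
    where
    Seen : Pred Bool 0ℓ
    Seen b = ∃[ a ] (∃[ w′ ] (w sees w′) × value w′ α ≡ a) × π₁ a ≡ b

    lower : ∀ b → b ∈ Seen → holds w (O α) ≤ b
    lower b (_ , (w′ , sees , refl) , refl) rewrite π₁-value w′ α with holds w (O α) in Oα
    ... | true  = ≤-reflexive (sym (sees Oα))
    ... | false = ≤-minimum _

    greatest : ∀ c → (∀ b → b ∈ Seen → c ≤ b) → c ≤ holds w (O α)
    greatest false _  = ≤-minimum _
    -- A lower bound `true` says that `α` holds at every seen world.
    greatest true  c≤ = ≤-reflexive (sym (holds-O-greatest w α λ w′ sees →
      true≤⇒≡ (c≤ _ (_ , (w′ , sees , refl) , π₁-value w′ α))))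
      where
      true≤⇒≡ : ∀ {b} → true ≤ b → b ≡ true
      true≤⇒≡ b≤b = refl

  -- A world exists only if some formula is unprovable, so nonemptiness is taken from a given world.
  canonical : World L → Model L
  canonical w = record
    { W = World L ; nonempty = w ; R = _sees_ ; serial = sees-serial ; v = value
    ; v-∧ = value-∧ ; v-∨ = value-∨ ; v-⇒ = value-⇒
    ; v-¬ = value-¬ L ; v-∘ = value-∘ L ; v-O = value-O }

theorem3p12 : ExcludedMiddle 0ℓ → (L : Logic) (Γ : Pred Formula 0ℓ) (φ : Formula) → Γ ⊨[ L ] φ → Γ ⊢[ L ] φ
theorem3p12 em L Γ φ Γ⊨φ = ⊩⇒⊢ (decidable-stable em refute)
  where
  refute : ((Γ ⊩[ L ] φ) → ⊥) → ⊥
  refute Γ⊮φ with w , Γ-holds , φ≡false ← lindenbaum em φ Γ Γ⊮φ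
    -- The Lindenbaum world is both the witness of nonemptiness and the point where `φ` fails.
    with Γ⊨φ (canonical em w) w (λ γ γ∈ → π₁⇒designated (trans (π₁-value w γ) (Γ-holds γ∈)))
  ... | designated with () ← trans (sym φ≡false) (trans (sym (π₁-value w φ)) (designated⇒π₁ designated))
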